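{- Every $d$-regular graph $G$ satisfies $\mathrm{wd}(G)\ge \lfloor d/2\rfloor+1$.
   Context: All graphs are finite and simple. A graph $G$ is $d$-regular if every vertex of $G$ has degree $d$. $\mathbb{N}$ denotes the nonnegative integers. Operation $\mathrm{Delete}(G,f,u)$: given a graph $G$, a function $f:V(G)\to\mathbb{N}$ and a vertex $u\in V(G)$, it outputs the graph $G'=G-u$ and the function $f':V(G')\to\mathbb{Z}$ with $f'(v)=f(v)-1$ if $uv\in E(G)$ and $f'(v)=f(v)$ otherwise. It is legal if $f'$ is nonnegative. Operation $\mathrm{DeleteSave}(G,f,u,w)$: given a graph $G$, a function $f:V(G)\to\mathbb{N}$ and adjacent vertices $u,w\in V(G)$, it outputs $G'=G-u$ and $f':V(G')\to\mathbb{Z}$ with $f'(v)=f(v)-1$ if $uv\in E(G)$ and $v\ne w$, and $f'(v)=f(v)$ otherwise. It is legal if $f(u)>f(w)$ and $f'$ is nonnegative. $G$ is weakly $f$-degenerate if it is possible to remove all vertices from $G$ by a sequence of legal applications of Delete and DeleteSave, starting from $(G,f)$, each operation being applied to the graph and function output by the previous one. For $k\in\mathbb{N}$, $G$ is weakly $k$-degenerate if it is weakly $f$-degenerate for the constant function $f\equiv k$. The weak degeneracy $\mathrm{wd}(G)$ is the minimum integer $k$ such that $G$ is weakly $k$-degenerate.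
   Formalization: The graph is assumed to have at least one vertex and d ≥ 1: the inequality fails for d = 0 (an edgeless graph has weak degeneracy 0 < 1) and for the null graph, which is vacuously d-regular with weak degeneracy 0. -}

module Defs where

open import Data.Bool using (Bool; _∧_; not; if_then_else_)
open import Data.Fin using (Fin; zero; suc; punchIn)
open import Data.Fin.Properties using (_≟_; any?; all?)
open import Data.Integer as ℤ using (ℤ; +_; 0ℤ; 1ℤ; ∣_∣)
import Data.Integer.Properties as ℤ
open import Data.Nat using (ℕ; zero; suc; _≤_; _<_; _>_; _<?_; z≤n; s≤s)
open import Data.Nat.Properties using (≤-refl; ≤-trans; n≤1+n)
open import Data.Product using (∃; _×_; _,_; proj₁; proj₂)
open import Data.Sum using (_⊎_; inj₁; inj₂)
open import Data.Vec using (count; allFin)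
open import Function using (_∘_)
open import Level using (0ℓ)
open import Relation.Binary.Core using (Rel)
open import Relation.Binary.Definitions using (Decidable; Symmetric)
open import Relation.Binary.PropositionalEquality using (_≡_)
open import Relation.Nullary using (¬_; Dec; yes; no; does; contradiction; map′; _×-dec_; _⊎-dec_)
import Relation.Unary as U

-- Finite simple graphs with vertex set Fin n.
record Graph (n : ℕ) : Set₁ where
  infix 4 _~_ _~?_
  field
    _~_    : Rel (Fin n) 0ℓ
    _~?_   : Decidable _~_
    ~-sym  : Symmetric _~_
    irrefl : ∀ {v} → ¬ (v ~ v)

degree : ∀ {n} → Graph n → Fin n → ℕ
degree {n} G v = count (v ~?_) (allFin n)
  where open Graph G

Regular : ∀ {n} → ℕ → Graph n → Set
Regular d G = ∀ v → degree G v ≡ d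

-- The vertices of G ∖ u are renumbered: vertex v of G ∖ u is the vertex
-- punchIn u v of G.
infixl 6 _∖_
_∖_ : ∀ {n} → Graph (suc n) → Fin (suc n) → Graph n
G ∖ u = record
  { _~_    = λ v w → punchIn u v ~ punchIn u w
  ; _~?_   = λ v w → punchIn u v ~? punchIn u w
  ; ~-sym  = ~-sym
  ; irrefl = irrefl
  }
  where open Graph G

decrementIf : Bool → ℕ → ℤ
decrementIf b m = if b then + m ℤ.- 1ℤ else + m

deleteFun : ∀ {n} → Graph (suc n) → (Fin (suc n) → ℕ) →
            Fin (suc n) → Fin n → ℤ
deleteFun G f u v′ = decrementIf (does (u ~? v)) (f v)
  where
  open Graph G
  v = punchIn u v′

deleteSaveFun : ∀ {n} → Graph (suc n) → (Fin (suc n) → ℕ) →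
                (u w : Fin (suc n)) → Fin n → ℤ
deleteSaveFun G f u w v′ =
  decrementIf (does (u ~? v) ∧ not (does (v ≟ w))) (f v)
  where
  open Graph G
  v = punchIn u v′

NonNegative : ∀ {n} → (Fin n → ℤ) → Set
NonNegative g = ∀ v → 0ℤ ℤ.≤ g v

-- After a legal operation the new function g is nonnegative, so ∣_∣ ∘ g is
-- just g regarded as ℕ-valued.
data WeaklyDegenerate : ∀ {n} → Graph n → (Fin n → ℕ) → Set₁ where
  empty      : ∀ {G : Graph 0} {f} → WeaklyDegenerate G f
  delete     : ∀ {n} {G : Graph (suc n)} {f} u →
               NonNegative (deleteFun G f u) →
               WeaklyDegenerate (G ∖ u) (∣_∣ ∘ deleteFun G f u) →
               WeaklyDegenerate G f
  deleteSave : ∀ {n} {G : Graph (suc n)} {f} u w →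
               Graph._~_ G u w →
               f u > f w →
               NonNegative (deleteSaveFun G f u w) →
               WeaklyDegenerate (G ∖ u) (∣_∣ ∘ deleteSaveFun G f u w) →
               WeaklyDegenerate G f

WeaklyKDegenerate : ∀ {n} → Graph n → ℕ → Set₁
WeaklyKDegenerate G k = WeaklyDegenerate G (λ _ → k)

nonNegative? : ∀ {n} (g : Fin n → ℤ) → Dec (NonNegative g)
nonNegative? g = all? (λ v → 0ℤ ℤ.≤? g v)

weaklyDegenerate? : ∀ {n} (G : Graph n) f → Dec (WeaklyDegenerate G f)
weaklyDegenerate? {zero}  G f = yes empty
weaklyDegenerate? {suc n} G f = map′ to from
  (any? (λ u →
      (nonNegative? (deleteFun G f u) ×-dec
       weaklyDegenerate? (G ∖ u) (∣_∣ ∘ deleteFun G f u))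
    ⊎-dec
      any? (λ w →
        (u ~? w) ×-dec (f w <? f u) ×-dec
        nonNegative? (deleteSaveFun G f u w) ×-dec
        weaklyDegenerate? (G ∖ u) (∣_∣ ∘ deleteSaveFun G f u w))))
  where
  open Graph G
  Move : Fin (suc n) → Set₁
  Move u =
      (NonNegative (deleteFun G f u) ×
       WeaklyDegenerate (G ∖ u) (∣_∣ ∘ deleteFun G f u))
    ⊎
      ∃ (λ w →
        (u ~ w) × (f w < f u) ×
        NonNegative (deleteSaveFun G f u w) ×
        WeaklyDegenerate (G ∖ u) (∣_∣ ∘ deleteSaveFun G f u w))
  to : ∃ Move → WeaklyDegenerate G f
  to (u , inj₁ (nn , r))               = delete u nn r
  to (u , inj₂ (w , adj , lt , nn , r)) = deleteSave u w adj lt nn r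
  from : WeaklyDegenerate G f → ∃ Move
  from (delete u nn r)              = u , inj₁ (nn , r)
  from (deleteSave u w adj lt nn r) = u , inj₂ (w , adj , lt , nn , r)

decrementIf-≥ : ∀ b {m k} → suc k ≤ m →
                (0ℤ ℤ.≤ decrementIf b m) × (k ≤ ∣ decrementIf b m ∣)
decrementIf-≥ Bool.true  (s≤s k≤m) = ℤ.+≤+ z≤n , k≤m
decrementIf-≥ Bool.false k<m       = ℤ.+≤+ z≤n , ≤-trans (n≤1+n _) k<m

order≤⇒weaklyDegenerate : ∀ {n} (G : Graph n) f → (∀ v → n ≤ f v) →
                          WeaklyDegenerate G f
order≤⇒weaklyDegenerate {zero}  G f n≤f = empty
order≤⇒weaklyDegenerate {suc n} G f n≤f = delete zero
  (λ v → proj₁ (bound v))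
  (order≤⇒weaklyDegenerate (G ∖ zero) _ (λ v → proj₂ (bound v)))
  where
  bound : ∀ v → (0ℤ ℤ.≤ deleteFun G f zero v) × (n ≤ ∣ deleteFun G f zero v ∣)
  bound v = decrementIf-≥ (does (Graph._~?_ G zero (suc v))) (n≤f (suc v))

IsMinimum : ∀ {ℓ} → U.Pred ℕ ℓ → ℕ → Set ℓ
IsMinimum P k = P k × (∀ j → P j → k ≤ j)

minimum : ∀ {ℓ} {P : U.Pred ℕ ℓ} → U.Decidable P → ∀ m → P m → ∃ (IsMinimum P)
minimum P? m pm with P? 0
minimum P? m       pm | yes p0 = 0 , p0 , λ _ _ → z≤n
minimum P? zero    pm | no ¬p0 = contradiction pm ¬p0
minimum P? (suc m) pm | no ¬p0 with minimum (P? ∘ suc) m pm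
... | k , pk , least = suc k , pk , λ
  { zero    p0 → contradiction p0 ¬p0
  ; (suc j) pj → s≤s (least j pj)
  }

weakDegeneracy : ∀ {n} (G : Graph n) → ∃ (IsMinimum (WeaklyKDegenerate G))
weakDegeneracy {n} G = minimum (λ k → weaklyDegenerate? G (λ _ → k)) n
  (order≤⇒weaklyDegenerate G (λ _ → n) (λ _ → ≤-refl))

wd : ∀ {n} → Graph n → ℕ
wd G = proj₁ (weakDegeneracy G)

wd-isMinimum : ∀ {n} (G : Graph n) → IsMinimum (WeaklyKDegenerate G) (wd G)
wd-isMinimum G = proj₂ (weakDegeneracy G)

{-# OPTIONS --safe #-}
module Submission where

open import Data.Nat using (ℕ; _+_; _≥_; _/_)
open import Defs

open import Data.Bool using (Bool; true; false; _∧_; not; if_then_else_)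
open import Data.Fin using (Fin; zero; suc; punchIn)
open import Data.Fin.Properties using (_≟_; punchInᵢ≢i)
open import Data.Integer as ℤ using (0ℤ; ∣_∣)
open import Data.Nat using (zero; suc; _*_; _≤_; _<_; z≤n; s≤s; z<s)
open import Data.Nat.DivMod using (m<n*o⇒m/o<n)
open import Data.Nat.Properties hiding (_≟_)
open import Data.Nat.Tactic.RingSolver using (solve-∀)
open import Data.Product using (proj₁)
open import Data.Vec using (count; tabulate)
open import Function using (id; _∘_)
open import Relation.Binary.PropositionalEquality
open import Relation.Nullary using (yes; no; does; contradiction)
open import Relation.Nullary.Decidable using (dec-false)
import Relation.Unary as U

open import Algebra.Properties.CommutativeMonoid.Sum +-0-commutativeMonoid
  using (sum; sum-syntax; sum-remove; sum-cong-≗; ∑-distrib-+)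

-- Each operation removing u removes deg u edges and lowers ∑ f by at least
-- deg u: Delete lowers it by deg u + f u, and DeleteSave by deg u − 1 + f u,
-- where f u > f w ≥ 0.  Hence |E| ≤ ∑ f for every weakly f-degenerate graph.
-- If f is constantly k, no vertex satisfies f u > f w, so the first operation
-- is a Delete and wastes k; thus |E| + k ≤ n k.  With 2 |E| = n d ≥ 1 this
-- gives d < 2 k.

indicator : Bool → ℕ
indicator b = if b then 1 else 0

sum-mono-≤ : ∀ {n} {f g : Fin n → ℕ} → (∀ v → f v ≤ g v) → sum f ≤ sum g
sum-mono-≤ {zero}  f≤g = z≤n
sum-mono-≤ {suc n} f≤g = +-mono-≤ (f≤g zero) (sum-mono-≤ (f≤g ∘ suc))

sum-const : ∀ n x → ∑[ _ < n ] x ≡ n * x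
sum-const zero    x = refl
sum-const (suc n) x = cong (x +_) (sum-const n x)

-- Generalised to any `t` because the recursion passes to `t ∘ suc`; `degree` is the case `t = id`,
-- as `allFin` is `tabulate id`.
count-tabulate : ∀ {n} {A : Set} {P : A → Set} (P? : U.Decidable P)
                 (t : Fin n → A) →
                 count P? (tabulate t) ≡ ∑[ v < n ] indicator (does (P? (t v)))
count-tabulate {zero}  P? t = refl
count-tabulate {suc n} P? t with does (P? (t zero))
... | true  = cong suc (count-tabulate P? (t ∘ suc))
... | false = count-tabulate P? (t ∘ suc)

-- Bounds the total decrement that a DeleteSave can spare, since it spares only `w`.
sum-indicator≤1 : ∀ {n} (w : Fin n) → ∑[ v < n ] indicator (does (v ≟ w)) ≤ 1
sum-indicator≤1 {suc n} w = begin
  ∑[ v < suc n ] δ v                ≡⟨ sum-remove {i = w} δ ⟩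
  δ w + ∑[ v < n ] δ (punchIn w v)  ≡⟨ cong (δ w +_) (sum-cong-≗ δ-punchIn) ⟩
  δ w + ∑[ v < n ] 0                ≡⟨ cong (δ w +_) (trans (sum-const n 0) (*-zeroʳ n)) ⟩
  δ w + 0                           ≡⟨ +-identityʳ (δ w) ⟩
  δ w                               ≤⟨ indicator≤1 (does (w ≟ w)) ⟩
  1                                 ∎
  where
  open ≤-Reasoning
  δ : Fin (suc n) → ℕ
  δ v = indicator (does (v ≟ w))
  δ-punchIn : ∀ v → δ (punchIn w v) ≡ 0
  δ-punchIn v = cong indicator (dec-false (punchIn w v ≟ w) (punchInᵢ≢i w v))
  indicator≤1 : ∀ b → indicator b ≤ 1
  indicator≤1 true  = ≤-refl
  indicator≤1 false = z≤n

adj : ∀ {n} → Graph n → Fin n → Fin n → ℕ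
adj G v w = indicator (does (Graph._~?_ G v w))

-- Twice the number of edges, as the sum of the adjacency matrix; working with it avoids both
-- unordered pairs and division by 2.
degreeSum : ∀ {n} → Graph n → ℕ
degreeSum {n} G = ∑[ v < n ] ∑[ w < n ] adj G v w

adj-irrefl : ∀ {n} (G : Graph n) v → adj G v v ≡ 0
adj-irrefl G v = cong indicator (dec-false (Graph._~?_ G v v) (Graph.irrefl G))

adj-sym : ∀ {n} (G : Graph n) v w → adj G v w ≡ adj G w v
adj-sym G v w with Graph._~?_ G v w | Graph._~?_ G w v
... | yes _   | yes _   = refl
... | no _    | no _    = refl
... | yes v~w | no w≁v  = contradiction (Graph.~-sym G v~w) w≁v
... | no v≁w  | yes w~v = contradiction (Graph.~-sym G w~v) v≁w

-- The degree of `u`, indexed by the vertices of `G ∖ u` so that it can be added termwise to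
-- functions on that graph.
removedEdges : ∀ {n} → Graph (suc n) → Fin (suc n) → ℕ
removedEdges {n} G u = ∑[ v < n ] adj G u (punchIn u v)

-- Row `u` and column `u` of the adjacency matrix each contribute `removedEdges G u`, by symmetry
-- and because the diagonal entry is 0.
degreeSum-∖ : ∀ {n} (G : Graph (suc n)) u →
              degreeSum G ≡ 2 * removedEdges G u + degreeSum (G ∖ u)
degreeSum-∖ {n} G u = begin
  degreeSum G
    ≡⟨ sum-remove {i = u} row ⟩
  row u + ∑[ v < n ] row (punchIn u v)
    ≡⟨ cong₂ _+_ row-u (sum-cong-≗ row-punchIn) ⟩
  D + ∑[ v < n ] (adj G u (punchIn u v) + ∑[ w < n ] adj (G ∖ u) v w)
    ≡⟨ cong (D +_) (∑-distrib-+ (adj G u ∘ punchIn u) (λ v → ∑[ w < n ] adj (G ∖ u) v w)) ⟩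
  D + (D + degreeSum (G ∖ u))
    ≡⟨ double D _ ⟩
  2 * D + degreeSum (G ∖ u) ∎
  where
  open ≡-Reasoning
  D : ℕ
  D = removedEdges G u
  row : Fin (suc n) → ℕ
  row v = ∑[ w < suc n ] adj G v w
  row-u : row u ≡ D
  row-u = trans (sum-remove {i = u} (adj G u)) (cong (_+ D) (adj-irrefl G u))
  row-punchIn : ∀ v → row (punchIn u v) ≡
                adj G u (punchIn u v) + ∑[ w < n ] adj (G ∖ u) v w
  row-punchIn v = trans (sum-remove {i = u} (adj G (punchIn u v)))
    (cong (_+ ∑[ w < n ] adj (G ∖ u) v w) (adj-sym G (punchIn u v) u))
  double : ∀ a b → a + (a + b) ≡ 2 * a + b
  double = solve-∀

-- Legality excludes `true` with `m = 0`, where `∣_∣` would turn -1 into 1 and the identity would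
-- fail.
decrementIf-+ : ∀ b m → 0ℤ ℤ.≤ decrementIf b m →
                indicator b + ∣ decrementIf b m ∣ ≡ m
decrementIf-+ true  (suc m) _ = refl
decrementIf-+ false m       _ = refl

delete-sum : ∀ {n} (G : Graph (suc n)) f u → NonNegative (deleteFun G f u) →
             sum f ≡ f u + (removedEdges G u + sum (∣_∣ ∘ deleteFun G f u))
delete-sum G f u nn = trans (sum-remove {i = u} f) (cong (f u +_)
  (trans (sum-cong-≗ (λ v → sym (decrementIf-+ _ _ (nn v))))
    (∑-distrib-+ (adj G u ∘ punchIn u) (∣_∣ ∘ deleteFun G f u))))

-- The decrement spared at `w` is paid for by the discarded value `f u`, which is at least 1 because
-- it exceeds `f w`.
deleteSave-sum : ∀ {n} (G : Graph (suc n)) f u w → f w < f u →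
                 NonNegative (deleteSaveFun G f u w) →
                 removedEdges G u + sum (∣_∣ ∘ deleteSaveFun G f u w) ≤ sum f
deleteSave-sum {n} G f u w fw<fu nn = begin
  removedEdges G u + sum (∣_∣ ∘ g)
    ≡⟨ ∑-distrib-+ (adj G u ∘ punchIn u) (∣_∣ ∘ g) ⟨
  ∑[ v < n ] (adj G u (punchIn u v) + ∣ g v ∣)
    -- At `w` the edge to `u` is charged to `δ`; at every other vertex it is charged to the
    -- decrement of `f`.
    ≤⟨ sum-mono-≤ pointwise ⟩
  ∑[ v < n ] (δ (punchIn u v) + f (punchIn u v))
    ≡⟨ ∑-distrib-+ (δ ∘ punchIn u) (f ∘ punchIn u) ⟩
  sum (δ ∘ punchIn u) + sum (f ∘ punchIn u)
    ≤⟨ +-monoˡ-≤ (sum (f ∘ punchIn u)) δ≤fu ⟩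
  f u + sum (f ∘ punchIn u)
    ≡⟨ sum-remove {i = u} f ⟨
  sum f ∎
  where
  open ≤-Reasoning
  g = deleteSaveFun G f u w
  δ : Fin (suc n) → ℕ
  δ v = indicator (does (v ≟ w))
  δ≤fu : sum (δ ∘ punchIn u) ≤ f u
  δ≤fu = begin
    sum (δ ∘ punchIn u)        ≤⟨ m≤n+m _ (δ u) ⟩
    δ u + sum (δ ∘ punchIn u)  ≡⟨ sum-remove {i = u} δ ⟨
    sum δ                      ≤⟨ sum-indicator≤1 w ⟩
    1                          ≤⟨ ≤-trans (s≤s z≤n) fw<fu ⟩
    f u                        ∎
  indicator-split : ∀ a b → indicator a ≤ indicator b + indicator (a ∧ not b)
  indicator-split false b     = z≤n
  indicator-split true  true  = ≤-refl
  indicator-split true  false = ≤-refl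
  pointwise : ∀ v → adj G u (punchIn u v) + ∣ g v ∣ ≤ δ (punchIn u v) + f (punchIn u v)
  pointwise v = begin
    indicator a + ∣ g v ∣                          ≤⟨ +-monoˡ-≤ ∣ g v ∣ (indicator-split a b) ⟩
    indicator b + indicator (a ∧ not b) + ∣ g v ∣  ≡⟨ +-assoc (indicator b) _ _ ⟩
    indicator b + (indicator (a ∧ not b) + ∣ g v ∣)
      ≡⟨ cong (indicator b +_) (decrementIf-+ (a ∧ not b) _ (nn v)) ⟩
    indicator b + f (punchIn u v)                  ∎
    where
    a = does (Graph._~?_ G u (punchIn u v))
    b = does (punchIn u v ≟ w)

-- The induction step shared by both operations: `t` and `s` are the sums of `f` before and after,
-- and `c` is a surplus loss beyond the removed edges, namely `f u` for Delete and 0 for DeleteSave.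
degreeSum-step : ∀ {n} (G : Graph (suc n)) u s c {t} →
                 c + (removedEdges G u + s) ≤ t → degreeSum (G ∖ u) ≤ 2 * s →
                 degreeSum G + 2 * c ≤ 2 * t
degreeSum-step G u s c {t} cost ih = begin
  degreeSum G + 2 * c                    ≡⟨ cong (_+ 2 * c) (degreeSum-∖ G u) ⟩
  2 * D + degreeSum (G ∖ u) + 2 * c      ≤⟨ +-monoˡ-≤ (2 * c) (+-monoʳ-≤ (2 * D) ih) ⟩
  2 * D + 2 * s + 2 * c                  ≡⟨ collect D s c ⟩
  2 * (c + (D + s))                      ≤⟨ *-monoʳ-≤ 2 cost ⟩
  2 * t                                  ∎
  where
  open ≤-Reasoning
  D : ℕ
  D = removedEdges G u
  collect : ∀ a b c → 2 * a + 2 * b + 2 * c ≡ 2 * (c + (a + b))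
  collect = solve-∀

weaklyDegenerate⇒degreeSum≤ : ∀ {n} {G : Graph n} {f} →
                              WeaklyDegenerate G f → degreeSum G ≤ 2 * sum f
weaklyDegenerate⇒degreeSum≤ empty = z≤n
weaklyDegenerate⇒degreeSum≤ {G = G} {f} (delete u nn r) =
  -- The surplus `2 * f u` is dropped here.
  m+n≤o⇒m≤o _ (degreeSum-step G u (sum (∣_∣ ∘ deleteFun G f u)) (f u)
    (≤-reflexive (sym (delete-sum G f u nn))) (weaklyDegenerate⇒degreeSum≤ r))
weaklyDegenerate⇒degreeSum≤ {G = G} {f} (deleteSave u w _ fw<fu nn r) =
  m+n≤o⇒m≤o _ (degreeSum-step G u (sum (∣_∣ ∘ deleteSaveFun G f u w)) 0
    (deleteSave-sum G f u w fw<fu nn) (weaklyDegenerate⇒degreeSum≤ r))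

-- Keeps the surplus of the first operation only: afterwards the function need not be constant, so
-- the general bound takes over.
weaklyKDegenerate⇒degreeSum≤ : ∀ {n} {G : Graph (suc n)} {k} →
                               WeaklyKDegenerate G k →
                               degreeSum G + 2 * k ≤ 2 * (suc n * k)
weaklyKDegenerate⇒degreeSum≤ {n} {G} {k} (delete u nn r) =
  subst (λ t → degreeSum G + 2 * k ≤ 2 * t) (sum-const (suc n) k)
    (degreeSum-step G u (sum (∣_∣ ∘ deleteFun G (λ _ → k) u)) k
      (≤-reflexive (sym (delete-sum G (λ _ → k) u nn)))
      (weaklyDegenerate⇒degreeSum≤ r))
weaklyKDegenerate⇒degreeSum≤ (deleteSave _ _ _ k<k _ _) = contradiction k<k (<-irrefl refl)

regular⇒degreeSum : ∀ {n d} (G : Graph n) → Regular d G → degreeSum G ≡ n * d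
regular⇒degreeSum {n} {d} G reg = trans
  (sum-cong-≗ (λ v → trans (sym (count-tabulate (Graph._~?_ G v) id)) (reg v)))
  (sum-const n d)

-- For positive `k` the term `2 * k` makes the inequality strict before `suc n` is cancelled. For
-- `k = 0` that term vanishes, and `d ≥ 1` contradicts the hypothesis.
d<2k : ∀ n d k → d ≥ 1 → suc n * d + 2 * k ≤ 2 * (suc n * k) → d < k * 2
d<2k n d zero d≥1 h = contradiction h (<⇒≱ (begin-strict
  2 * (n * 0)    ≡⟨ cong (2 *_) (*-zeroʳ n) ⟩
  0              <⟨ d≥1 ⟩
  d              ≤⟨ m≤m+n d (n * d) ⟩
  suc n * d      ≤⟨ m≤m+n (suc n * d) 0 ⟩
  suc n * d + 0  ∎))
  where open ≤-Reasoning
d<2k n d k@(suc _) _ h = *-cancelˡ-< (suc n) d (k * 2) (begin-strict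
  suc n * d          <⟨ m<m+n (suc n * d) z<s ⟩
  suc n * d + 2 * k  ≤⟨ h ⟩
  2 * (suc n * k)    ≡⟨ *-comm 2 (suc n * k) ⟩
  suc n * k * 2      ≡⟨ *-assoc (suc n) k 2 ⟩
  suc n * (k * 2)    ∎)
  where open ≤-Reasoning

theorem2 : ∀ (n d : ℕ) → n ≥ 1 → d ≥ 1 → (G : Graph n) → Regular d G →
    wd G ≥ d / 2 + 1
theorem2 (suc n) d _ d≥1 G reg = subst (_≤ wd G) (+-comm 1 (d / 2))
  -- This yields `d / 2 < wd G`, which unfolds to `1 + d / 2 ≤ wd G`.
  (m<n*o⇒m/o<n (d<2k n d (wd G) d≥1
    (subst (λ s → s + 2 * wd G ≤ 2 * (suc n * wd G)) (regular⇒degreeSum G reg)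
      (weaklyKDegenerate⇒degreeSum≤ {G = G} (proj₁ (wd-isMinimum G))))))
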